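{- For any integers $k, m \ge 1$: if both $k$ and $m$ are even, then \[ 2O(k,m) = B(k,m) + B\!\left(\tfrac{k}{2}, \tfrac{m-2}{2}\right) - B\!\left(\tfrac{k}{2}, \tfrac{m}{2}\right) - B\!\left(\tfrac{k-2}{2}, \tfrac{m-2}{2}\right); \] otherwise, \[ 2O(k,m) = B(k,m) - 2B\!\left(\left\lfloor \tfrac{k}{2}\right\rfloor, \left\lfloor \tfrac{m-1}{2}\right\rfloor\right). \]
   Context: For $k \ge 1$, $m \ge 0$, $\mathcal{B}(k,m)$ is the set of binary words of length $m$ that avoid (do not contain as a not-necessarily-contiguous subsequence) every word $0^j1^{k-j}$, $j\in\{0,\dots,k\}$, and $B(k,m) = |\mathcal{B}(k,m)|$; also $B(0,m) = 0$ for all $m \ge 0$ (so $B(k,0)=1$ for $k\ge1$). For a binary word $w=w_1\cdots w_n$, $G(w)$ is the permutation of $[n]$ listing first the positions of zeros of $w$ in increasing order, then the positions of ones in increasing order; $w$ is odd if $G(w)$ has an odd number of inversions. $O(k,m)$ is the number of odd words in $\mathcal{B}(k,m)$. -}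

module Defs where

open import Data.Fin using (Fin; toℕ) renaming (_<?_ to _<ᶠ?_)
open import Data.Fin.Patterns using (0F; 1F)
open import Data.Fin.Properties using (all?) renaming (_≟_ to _≟ᶠ_)
open import Data.List using (List; []; _∷_; _++_; allFin; cartesianProductWith; filter; length; replicate)
open import Data.List.Relation.Binary.Sublist.DecPropositional (_≟ᶠ_ {2}) using (_⊆_; _⊆?_)
open import Data.Nat using (ℕ; zero; suc; _+_; _∸_)
open import Data.Nat.Divisibility using (_∣_; _∣?_)
open import Data.Vec as Vec using (Vec; lookup; toList)
open import Relation.Nullary using (¬_; Dec)
open import Relation.Nullary.Decidable using (¬?; _×-dec_)

Word : ℕ → Set
Word m = Vec (Fin 2) m

words : ∀ m → List (Word m)
words zero    = Vec.[] ∷ []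
words (suc m) = cartesianProductWith Vec._∷_ (0F ∷ 1F ∷ []) (words m)

-- The word 0ʲ1ᵏ⁻ʲ; only used for j ≤ k.
pattern01 : (k j : ℕ) → List (Fin 2)
pattern01 k j = replicate j 0F ++ replicate (k ∸ j) 1F

-- _⊆_ on lists is the (not necessarily contiguous) subsequence relation.
Avoids : ℕ → ∀ {m} → Word m → Set
Avoids k w = (j : Fin (suc k)) → ¬ (pattern01 k (toℕ j) ⊆ toList w)

avoids? : ∀ k {m} (w : Word m) → Dec (Avoids k w)
avoids? k w = all? λ j → ¬? (pattern01 k (toℕ j) ⊆? toList w)

B : ℕ → ℕ → ℕ
B zero      m = 0
B k@(suc _) m = length (filter (avoids? k) (words m))

-- G w in one-line notation, with positions numbered from 0 instead of 1.
G : ∀ {n} → Word n → List (Fin n)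
G {n} w = filter (λ i → lookup w i ≟ᶠ 0F) (allFin n)
       ++ filter (λ i → lookup w i ≟ᶠ 1F) (allFin n)

inversions : ∀ {n} → List (Fin n) → ℕ
inversions []       = 0
inversions (x ∷ xs) = length (filter (_<ᶠ? x) xs) + inversions xs

OddWord : ∀ {n} → Word n → Set
OddWord w = ¬ (2 ∣ inversions (G w))

oddWord? : ∀ {n} (w : Word n) → Dec (OddWord w)
oddWord? w = ¬? (2 ∣? inversions (G w))

O : ℕ → ℕ → ℕ
O k m = length (filter (λ w → avoids? k w ×-dec oddWord? w) (words m))

{-# OPTIONS --safe #-}
module Submission where

open import Defs
open import Data.Integer using (+_; _+_; _-_; _*_)
open import Data.Nat using (ℕ; _∸_; _/_; _≤_)
open import Data.Nat.Divisibility using (_∣_)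
open import Data.Product using (_×_)
open import Relation.Binary.PropositionalEquality using (_≡_)
open import Relation.Nullary using (¬_)

open import Data.Bool using (Bool; true; false; T; not; _∧_; if_then_else_)
open import Data.Empty using (⊥-elim)
open import Data.Fin using (Fin; zero; suc; toℕ; fromℕ<) renaming (_<?_ to _<ᶠ?_)
open import Data.Fin.Patterns using (0F; 1F)
open import Data.Fin.Properties using (toℕ-fromℕ<; toℕ≤pred[n]) renaming (_≟_ to _≟ᶠ_)
open import Data.Integer using (ℤ; 0ℤ; 1ℤ; -1ℤ)
open import Data.Integer.Properties using (+-identityˡ; +-identityʳ; +-inverseʳ; +-assoc; *-zeroʳ; *-distribˡ-+)
open import Data.Integer.Tactic.RingSolver using (solve-∀)
open import Data.List using (List; []; _∷_; _++_; map; filter; length; replicate; allFin; tabulate)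
open import Data.List.Properties using (map-tabulate; length-map; map-++)
open import Data.List.Relation.Binary.Sublist.Propositional using (_⊆_; []; _∷_; _∷ʳ_; minimum)
open import Data.Nat using (zero; suc; pred; _<_; _⊔_; z≤n; s≤s; z<s; s<s)
import Data.Nat as ℕ
open import Data.Nat.DivMod using (m*n/n≡m; +-distrib-/-∣ʳ)
open import Data.Nat.Divisibility using (_∣?_; divides)
import Data.Nat.Properties as ℕₚ
open import Algebra.Properties.CommutativeSemigroup ℕₚ.+-commutativeSemigroup using (x∙yz≈y∙xz)
open import Data.Product using (_,_; ∃; ∃₂; proj₁; proj₂)
open import Data.Sign as Sign using (Sign; opposite)
import Data.Sign.Properties as Signₚ
open import Data.Sum using (_⊎_; inj₁; inj₂)
open import Data.Vec as Vec using (lookup; toList)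
open import Function using (_∘_; id)
open import Relation.Binary.PropositionalEquality using (refl; sym; trans; cong; cong₂; subst; module ≡-Reasoning)
open import Relation.Nullary using (Dec; yes; no; does; contradiction)
open import Relation.Nullary.Decidable using (_×-dec_)
open import Relation.Unary using (Decidable)

-- A word lies in 𝓑(k,m) iff its longest subsequence 0ʲ1ˡ has length L < k.  Read
-- the word from left to right, remembering of the prefix u read so far
-- d = L(u) − #zeros(u), r = k − L(u) and s = (−1)^#ones(u).  A letter 1 changes
-- (d, r, s) to (d+1, r−1, −s); a letter 0 multiplies the sign by s and changes
-- (d, r) to (d−1, r), or (0, r) to (0, r−1).  In two consecutive letters the
-- contributions of 01 and 10 cancel unless d = 0, so on blocks of two letters
-- the signed count satisfies, up to a correction at d = 0, the recursion of
-- the unsigned count with m, d and r halved.  The correction is a difference D of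
-- two neighbouring unsigned counts, and this yields a closed form for the
-- signed count B(k,m) − 2 O(k,m).

-- Signed and unsigned transfer recursions

σ : Sign → ℤ
σ Sign.+ = 1ℤ
σ Sign.- = -1ℤ

-- C n d r and E n s d r are the number and the signed number of accepted words of
-- length n from state (d, r, s); r = 0 is a rejecting sink.
C : ℕ → ℕ → ℕ → ℤ
C zero    d       zero    = 0ℤ
C zero    d       (suc r) = 1ℤ
C (suc n) zero    r       = C n 0 (pred r) + C n 1 (pred r)
C (suc n) (suc d) r       = C n d r + C n (suc (suc d)) (pred r)

E : ℕ → Sign → ℕ → ℕ → ℤ
E zero    s d       zero    = 0ℤ
E zero    s d       (suc r) = 1ℤ
E (suc n) s zero    r       = σ s * E n s 0 (pred r) + E n (opposite s) 1 (pred r)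
E (suc n) s (suc d) r       = σ s * E n s d r + E n (opposite s) (suc (suc d)) (pred r)

C-zero : ∀ n d → C n d 0 ≡ 0ℤ
C-zero zero    d       = refl
C-zero (suc n) zero    rewrite C-zero n 0 | C-zero n 1 = refl
C-zero (suc n) (suc d) rewrite C-zero n d | C-zero n (suc (suc d)) = refl

E-zero : ∀ n s d → E n s d 0 ≡ 0ℤ
E-zero zero    s d       = refl
E-zero (suc n) s zero    rewrite E-zero n s 0 | E-zero n (opposite s) 1 | *-zeroʳ (σ s) = refl
E-zero (suc n) s (suc d) rewrite E-zero n s d | E-zero n (opposite s) (suc (suc d)) | *-zeroʳ (σ s) = refl

-- The four terms belong to 00, 01, 10 and 11 in this order. From `d = 0` the words 01 and 10 end in
-- different states, `(1, r - 2)` and `(0, r - 1)`, so they do not cancel.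
E-two-0 : ∀ n s r → E (suc (suc n)) s 0 r ≡
  E n s 0 (pred (pred r)) + σ s * E n (opposite s) 1 (pred (pred r))
  - σ s * E n (opposite s) 0 (pred r) + E n s 2 (pred (pred r))
E-two-0 n Sign.+ r = identity (E n Sign.+ 0 (pred (pred r))) (E n Sign.- 1 (pred (pred r)))
                                (E n Sign.- 0 (pred r)) (E n Sign.+ 2 (pred (pred r)))
  where
  identity : ∀ a b c d → 1ℤ * (1ℤ * a + b) + (-1ℤ * c + d) ≡ a + 1ℤ * b - 1ℤ * c + d
  identity = solve-∀
E-two-0 n Sign.- r = identity (E n Sign.- 0 (pred (pred r))) (E n Sign.+ 1 (pred (pred r)))
                                (E n Sign.+ 0 (pred r)) (E n Sign.- 2 (pred (pred r)))
  where
  identity : ∀ a b c d → -1ℤ * (-1ℤ * a + b) + (1ℤ * c + d) ≡ a + -1ℤ * b - -1ℤ * c + d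
  identity = solve-∀

-- Here `b` is the common end state of 01 and 10 when `d` is positive: the letter 0 is read with
-- sign `s` in the first and with the opposite sign in the second. Only 00 and 11 survive.
pair-cancel : ∀ s a b c → σ s * (σ s * a + b) + (σ (opposite s) * b + c) ≡ a + c
pair-cancel Sign.+ = identity
  where
  identity : ∀ a b c → 1ℤ * (1ℤ * a + b) + (-1ℤ * b + c) ≡ a + c
  identity = solve-∀
pair-cancel Sign.- = identity
  where
  identity : ∀ a b c → -1ℤ * (-1ℤ * a + b) + (1ℤ * b + c) ≡ a + c
  identity = solve-∀

E-two-1 : ∀ n s r → E (suc (suc n)) s 1 r ≡ E n s 0 (pred r) + E n s 3 (pred (pred r))
E-two-1 n s r rewrite Signₚ.opposite-involutive s = pair-cancel s _ _ _

E-two-2 : ∀ n s d r → E (suc (suc n)) s (suc (suc d)) r ≡ E n s d r + E n s (4 ℕ.+ d) (pred (pred r))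
E-two-2 n s d r rewrite Signₚ.opposite-involutive s = pair-cancel s _ _ _

-- The difference C (n − 1) (f − 1) q − C (n − 1) f q, where C n (−1) q is read as
-- C n 0 (q − 1), the convention under which both clauses of C agree.
D : ℕ → ℕ → ℕ → ℤ
D zero    f       q = 0ℤ
D (suc n) zero    q = C n 0 (pred q) - C n 0 q
D (suc n) (suc f) q = C n f q - C n (suc f) q

C₀-const : ∀ d e r → C 0 d r ≡ C 0 e r
C₀-const d e zero    = refl
C₀-const d e (suc r) = refl

-‿interchange : ∀ a b c d → (a + b) - (c + d) ≡ (a - c) + (b - d)
-‿interchange = solve-∀

-- By linearity differences of `C` inherit its recursion for positive `d`. The convention at index 0
-- is what makes this hold for `f = 0` as well.
D-suc : ∀ n f q → D (suc n) (suc f) q ≡ D n f q + D n (suc (suc f)) (pred q)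
D-suc zero    f q rewrite C₀-const f (suc f) q = +-inverseʳ (C 0 (suc f) q)
D-suc (suc n) zero q = -‿interchange (C n 0 (pred q)) (C n 1 (pred q)) (C n 0 q) (C n 2 (pred q))
D-suc (suc n) (suc f) q = -‿interchange (C n f q) (C n (2 ℕ.+ f) (pred q)) (C n (suc f) q) (C n (3 ℕ.+ f) (pred q))

D-zero : ∀ n f → D n f 0 ≡ 0ℤ
D-zero zero    f       = refl
D-zero (suc n) zero    rewrite C-zero n 0 = refl
D-zero (suc n) (suc f) rewrite C-zero n f | C-zero n (suc f) = refl

-- Simultaneous induction on `n` over the parities of `d` and `r`. In all four main terms `r` and
-- `d + r` are halved and rounded up; the correction carries the sign `s` exactly when `d + r` is
-- even.
E-even-even : ∀ n s e q → E (n ℕ.* 2) s (e ℕ.* 2) (q ℕ.* 2) ≡ C n e q + σ s * D n e q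
E-odd-odd : ∀ n s e q → E (n ℕ.* 2) s (suc (e ℕ.* 2)) (suc (q ℕ.* 2)) ≡ C n e (suc q) + σ s * D n (suc e) q
E-even-odd : ∀ n s e q → E (n ℕ.* 2) s (e ℕ.* 2) (suc (q ℕ.* 2)) ≡ C n e (suc q) + D n (suc e) q
E-odd-even : ∀ n s e q → E (n ℕ.* 2) s (suc (e ℕ.* 2)) (q ℕ.* 2) ≡ C n (suc e) q + D n (suc (suc e)) (pred q)

linear : ∀ σ a b c d → (a + σ * b) + (c + σ * d) ≡ (a + c) + σ * (b + d)
linear = solve-∀

interchange : ∀ a b c d → (a + b) + (c + d) ≡ (a + c) + (b + d)
interchange = solve-∀

E-even-even n s e zero
  rewrite E-zero (n ℕ.* 2) s (e ℕ.* 2) | C-zero n e | D-zero n e | *-zeroʳ (σ s) = refl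
E-even-even zero s e (suc q) rewrite *-zeroʳ (σ s) = refl
E-even-even (suc n) s zero (suc q)
  rewrite E-two-0 (n ℕ.* 2) s (suc q ℕ.* 2)
        | E-even-even n s 0 q
        | E-odd-even n (opposite s) 0 q
        | E-even-odd n (opposite s) 0 q
        | E-even-even n s 1 q
  -- The corrections `D n 1 q` from 10 and 11 cancel. By `D-suc` those from 00 and 01 add up to
  -- `C n 0 q - C n 1 q`, and the uncancelled main terms of 01 and 10 turn this into
  -- `D (suc n) 0 (suc q)`.
  = trans (identity (σ s) (C n 0 q) (D n 0 q) (C n 1 q) (D n 2 (pred q)) (C n 0 (suc q)) (D n 1 q))
          (cong (λ t → C n 0 q + C n 1 q + σ s * t)
            (trans (cong (λ t → t + C n 1 q - C n 0 (suc q)) (sym (D-suc n 0 q)))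
                   (cancel (C n 0 q) (C n 1 q) (C n 0 (suc q)))))
  where
  identity : ∀ σ a t b u c v →
    (a + σ * t) + σ * (b + u) - σ * (c + v) + (b + σ * v) ≡ a + b + σ * (t + u + b - c)
  identity = solve-∀
  cancel : ∀ a b c → a - b + b - c ≡ a - c
  cancel = solve-∀
E-even-even (suc n) s (suc e) (suc q)
  rewrite E-two-2 (n ℕ.* 2) s (e ℕ.* 2) (suc q ℕ.* 2)
        | E-even-even n s e (suc q)
        | E-even-even n s (2 ℕ.+ e) q
        | D-suc n e (suc q)
  = linear (σ s) (C n e (suc q)) _ _ _

E-odd-odd zero s e q rewrite *-zeroʳ (σ s) = refl
-- For `r = 1` the value `pred (pred r)` is 0, which is not odd: the branch 11 ends in the sink and
-- is treated apart from the induction hypothesis.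
E-odd-odd (suc n) s zero zero
  rewrite E-two-1 (n ℕ.* 2) s 1
        | E-zero (n ℕ.* 2) s 0
        | E-zero (n ℕ.* 2) s 3
        | D-zero (suc n) 1 | C-zero n 0 | C-zero n 1 | *-zeroʳ (σ s) = refl
-- From `d = 1` the word 00 ends at `d = 0` with `r` lowered by one, so the even-even form enters
-- and supplies the first summand of the clause of `C` at 0.
E-odd-odd (suc n) s zero (suc q)
  rewrite E-two-1 (n ℕ.* 2) s (suc (suc q ℕ.* 2))
        | E-even-even n s 0 (suc q)
        | E-odd-odd n s 1 q
        | D-suc n 0 (suc q)
  = linear (σ s) (C n 0 (suc q)) _ _ _
E-odd-odd (suc n) s (suc e) zero
  rewrite E-two-2 (n ℕ.* 2) s (suc (e ℕ.* 2)) 1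
        | E-odd-odd n s e 0
        | E-zero (n ℕ.* 2) s (suc ((2 ℕ.+ e) ℕ.* 2))
        | D-suc n (suc e) 0 | D-zero n (suc e) | D-zero n (3 ℕ.+ e) | C-zero n (2 ℕ.+ e)
  = identity (C n e 1) (σ s)
  where
  identity : ∀ a σ → a + σ * 0ℤ + 0ℤ ≡ a + 0ℤ + σ * 0ℤ
  identity = solve-∀
E-odd-odd (suc n) s (suc e) (suc q)
  rewrite E-two-2 (n ℕ.* 2) s (suc (e ℕ.* 2)) (suc (suc q ℕ.* 2))
        | E-odd-odd n s e (suc q)
        | E-odd-odd n s (2 ℕ.+ e) q
        | D-suc n (suc e) (suc q)
  = linear (σ s) (C n e (suc (suc q))) _ _ _

E-even-odd zero s e q = refl
E-even-odd (suc n) s zero zero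
  rewrite E-two-0 (n ℕ.* 2) s 1
        | E-zero (n ℕ.* 2) s 0
        | E-zero (n ℕ.* 2) s 2
        | E-zero (n ℕ.* 2) (opposite s) 0
        | E-zero (n ℕ.* 2) (opposite s) 1
        | C-zero n 0 | C-zero n 1 | *-zeroʳ (σ s) = refl
E-even-odd (suc n) s zero (suc q)
  rewrite E-two-0 (n ℕ.* 2) s (suc (suc q ℕ.* 2))
        | E-even-odd n s 0 q
        | E-odd-odd n (opposite s) 0 q
        | E-even-even n (opposite s) 0 (suc q)
        | E-even-odd n s 1 q
        | D-suc n 0 (suc q)
  = identity s (C n 0 (suc q)) (D n 1 q) (D n 0 (suc q)) (C n 1 (suc q)) (D n 2 q)
  where
  identity⁺ : ∀ a t u b v →
    (a + t) + 1ℤ * (a + -1ℤ * t) - 1ℤ * (a + -1ℤ * u) + (b + v) ≡ a + b + (u + v)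
  identity⁺ = solve-∀
  identity⁻ : ∀ a t u b v →
    (a + t) + -1ℤ * (a + 1ℤ * t) - -1ℤ * (a + 1ℤ * u) + (b + v) ≡ a + b + (u + v)
  identity⁻ = solve-∀
  -- The terms in `t` cancel and `u` gets its positive sign because `σ s * σ (opposite s)` is -1,
  -- which the ring solver sees only once `s` is fixed.
  identity : ∀ s a t u b v →
    (a + t) + σ s * (a + σ (opposite s) * t) - σ s * (a + σ (opposite s) * u) + (b + v) ≡ a + b + (u + v)
  identity Sign.+ = identity⁺
  identity Sign.- = identity⁻
E-even-odd (suc n) s (suc e) zero
  rewrite E-two-2 (n ℕ.* 2) s (e ℕ.* 2) 1
        | E-even-odd n s e 0
        | E-zero (n ℕ.* 2) s ((2 ℕ.+ e) ℕ.* 2)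
        | D-suc n (suc e) 0 | D-zero n (suc e) | D-zero n (3 ℕ.+ e) | C-zero n (2 ℕ.+ e)
  = refl
E-even-odd (suc n) s (suc e) (suc q)
  rewrite E-two-2 (n ℕ.* 2) s (e ℕ.* 2) (suc (suc q ℕ.* 2))
        | E-even-odd n s e (suc q)
        | E-even-odd n s (2 ℕ.+ e) q
        | D-suc n (suc e) (suc q)
  = interchange (C n e (suc (suc q))) _ _ _

E-odd-even n s e zero
  rewrite E-zero (n ℕ.* 2) s (suc (e ℕ.* 2)) | C-zero n (suc e) | D-zero n (suc (suc e)) = refl
E-odd-even zero s e (suc q) = refl
E-odd-even (suc n) s zero (suc q)
  rewrite E-two-1 (n ℕ.* 2) s (suc q ℕ.* 2)
        | E-even-odd n s 0 q
        | E-odd-even n s 1 q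
        | D-suc n 1 q
  = interchange (C n 0 (suc q)) _ _ _
E-odd-even (suc n) s (suc e) (suc q)
  rewrite E-two-2 (n ℕ.* 2) s (suc (e ℕ.* 2)) (suc q ℕ.* 2)
        | E-odd-even n s e (suc q)
        | E-odd-even n s (2 ℕ.+ e) q
        | D-suc n (suc (suc e)) q
  = interchange (C n (suc e) (suc q)) _ _ _

-- Closed forms from the initial state

E-even-length-even : ∀ n j →
  E (suc n ℕ.* 2) Sign.+ 0 (j ℕ.* 2) ≡ C (suc n) 0 j + C n 0 (pred j) - C n 0 j
E-even-length-even n j = trans (E-even-even (suc n) Sign.+ 0 j) (identity (C (suc n) 0 j) _ _)
  where
  identity : ∀ a b c → a + 1ℤ * (b - c) ≡ a + b - c
  identity = solve-∀

-- The main term unfolds to `C n 0 j + C n 1 j` and the correction is `C n 0 j - C n 1 j`.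
E-even-length-odd : ∀ n j → E (suc n ℕ.* 2) Sign.+ 0 (suc (j ℕ.* 2)) ≡ + 2 * C n 0 j
E-even-length-odd n j = trans (E-even-odd (suc n) Sign.+ 0 j) (identity (C n 0 j) (C n 1 j))
  where
  identity : ∀ a b → a + b + (a - b) ≡ + 2 * a
  identity = solve-∀

-- Splitting off the first letter leaves even length; by `D-suc` the two corrections combine to
-- `C n 0 j - C n 1 j`.
E-odd-length-odd : ∀ n j → E (suc (n ℕ.* 2)) Sign.+ 0 (suc (j ℕ.* 2)) ≡ + 2 * C n 0 j
E-odd-length-odd n j
  rewrite E-even-even n Sign.+ 0 j | E-odd-even n Sign.- 0 j
  = trans (identity₁ (C n 0 j) (D n 0 j) (C n 1 j) (D n 2 (pred j)))
          (trans (cong (λ t → C n 0 j + C n 1 j + t) (sym (D-suc n 0 j)))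
                 (identity₂ (C n 0 j) (C n 1 j)))
  where
  identity₁ : ∀ a t b u → 1ℤ * (a + 1ℤ * t) + (b + u) ≡ a + b + (t + u)
  identity₁ = solve-∀
  identity₂ : ∀ a b → a + b + (a - b) ≡ + 2 * a
  identity₂ = solve-∀

-- Both first letters lead to the same main term, and their corrections are opposite: the one after
-- 1 carries the sign, now negative, and the one after 0 does not.
E-odd-length-even : ∀ n j → E (suc (n ℕ.* 2)) Sign.+ 0 (j ℕ.* 2) ≡ + 2 * C n 0 j
E-odd-length-even n zero
  rewrite E-zero (n ℕ.* 2) Sign.+ 0 | E-zero (n ℕ.* 2) Sign.- 1 | C-zero n 0 = refl
E-odd-length-even n (suc j)
  rewrite E-even-odd n Sign.+ 0 j | E-odd-odd n Sign.- 0 j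
  = identity (C n 0 (suc j)) (D n 1 j)
  where
  identity : ∀ a t → 1ℤ * (a + t) + (a + -1ℤ * t) ≡ + 2 * a
  identity = solve-∀

-- Longest subsequences of the form 0ʲ1ˡ

ones : ∀ {n} → Word n → ℕ
ones Vec.[]         = 0
ones (0F Vec.∷ w) = ones w
ones (1F Vec.∷ w) = suc (ones w)

longest : ∀ {n} → Word n → ℕ
longest Vec.[]         = 0
longest (0F Vec.∷ w) = suc (longest w)
longest (1F Vec.∷ w) = suc (ones w) ⊔ longest w

ones≤longest : ∀ {n} (w : Word n) → ones w ≤ longest w
ones≤longest Vec.[]       = z≤n
ones≤longest (0F Vec.∷ w) = ℕₚ.m≤n⇒m≤1+n (ones≤longest w)
ones≤longest (1F Vec.∷ w) = ℕₚ.m≤m⊔n _ (longest w)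

1ˡ⊆⇒≤ones : ∀ {n} l (w : Word n) → replicate l 1F ⊆ toList w → l ≤ ones w
1ˡ⊆⇒≤ones zero    w            p          = z≤n
1ˡ⊆⇒≤ones (suc l) (0F Vec.∷ w) (_ ∷ʳ p)   = 1ˡ⊆⇒≤ones (suc l) w p
1ˡ⊆⇒≤ones (suc l) (0F Vec.∷ w) (() ∷ p)
1ˡ⊆⇒≤ones (suc l) (1F Vec.∷ w) (_ ∷ʳ p)   = ℕₚ.m≤n⇒m≤1+n (1ˡ⊆⇒≤ones (suc l) w p)
1ˡ⊆⇒≤ones (suc l) (1F Vec.∷ w) (_ ∷ p)    = s≤s (1ˡ⊆⇒≤ones l w p)

≤ones⇒1ˡ⊆ : ∀ {n} l (w : Word n) → l ≤ ones w → replicate l 1F ⊆ toList w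
≤ones⇒1ˡ⊆ zero    w            _       = minimum _
≤ones⇒1ˡ⊆ (suc l) (0F Vec.∷ w) l<      = 0F ∷ʳ ≤ones⇒1ˡ⊆ (suc l) w l<
≤ones⇒1ˡ⊆ (suc l) (1F Vec.∷ w) (s≤s l≤) = refl ∷ ≤ones⇒1ˡ⊆ l w l≤

0ʲ1ˡ⊆⇒≤longest : ∀ {n} j l (w : Word n) → replicate j 0F ++ replicate l 1F ⊆ toList w → j ℕ.+ l ≤ longest w
0ʲ1ˡ⊆⇒≤longest zero    zero    w            p        = z≤n
0ʲ1ˡ⊆⇒≤longest (suc j) l       (0F Vec.∷ w) (_ ∷ʳ p) = ℕₚ.m≤n⇒m≤1+n (0ʲ1ˡ⊆⇒≤longest (suc j) l w p)
0ʲ1ˡ⊆⇒≤longest (suc j) l       (0F Vec.∷ w) (_ ∷ p)  = s≤s (0ʲ1ˡ⊆⇒≤longest j l w p)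
0ʲ1ˡ⊆⇒≤longest (suc j) l       (1F Vec.∷ w) (_ ∷ʳ p) = ℕₚ.m≤n⇒m≤o⊔n _ (0ʲ1ˡ⊆⇒≤longest (suc j) l w p)
0ʲ1ˡ⊆⇒≤longest (suc j) l       (1F Vec.∷ w) (() ∷ p)
0ʲ1ˡ⊆⇒≤longest zero    (suc l) w            p        =
  ℕₚ.≤-trans (1ˡ⊆⇒≤ones (suc l) w p) (ones≤longest w)

-- Every length up to the longest is attained, so a word with `longest w` at least `k` contains a
-- forbidden word of length exactly `k`.
≤longest⇒0ʲ1ˡ⊆ : ∀ {n} t (w : Word n) → t ≤ longest w →
  ∃₂ λ j l → j ℕ.+ l ≡ t × replicate j 0F ++ replicate l 1F ⊆ toList w
≤longest⇒0ʲ1ˡ⊆ zero    w            _        = 0 , 0 , refl , minimum _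
≤longest⇒0ʲ1ˡ⊆ (suc t) (0F Vec.∷ w) (s≤s t≤) with ≤longest⇒0ʲ1ˡ⊆ t w t≤
... | j , l , eq , p = suc j , l , cong suc eq , refl ∷ p
≤longest⇒0ʲ1ˡ⊆ (suc t) (1F Vec.∷ w) t≤ with ℕₚ.⊔-sel (suc (ones w)) (longest w)
... | inj₁ eq = 0 , suc t , refl , ≤ones⇒1ˡ⊆ (suc t) (1F Vec.∷ w) (subst (suc t ≤_) eq t≤)
... | inj₂ eq with ≤longest⇒0ʲ1ˡ⊆ (suc t) w (subst (suc t ≤_) eq t≤)
...   | j , l , eq′ , p = j , l , eq′ , 1F ∷ʳ p

avoids⇒longest< : ∀ k {n} (w : Word n) → Avoids k w → longest w < k
avoids⇒longest< k w av = ℕₚ.≰⇒> λ k≤ → occurs (≤longest⇒0ʲ1ˡ⊆ k w k≤)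
  where
  occurs : ¬ (∃₂ λ j l → j ℕ.+ l ≡ k × replicate j 0F ++ replicate l 1F ⊆ toList w)
  occurs (j , l , refl , p) = av (fromℕ< j<) (subst (_⊆ toList w) (sym eq) p)
    where
    j< : j < suc (j ℕ.+ l)
    j< = s≤s (ℕₚ.m≤m+n j l)
    eq : pattern01 k (toℕ (fromℕ< j<)) ≡ replicate j 0F ++ replicate l 1F
    eq rewrite toℕ-fromℕ< j< | ℕₚ.m+n∸m≡n j l = refl

longest<⇒avoids : ∀ k {n} (w : Word n) → longest w < k → Avoids k w
longest<⇒avoids k w L<k j p = ℕₚ.<⇒≱ L<k
  (subst (_≤ longest w) (ℕₚ.m+[n∸m]≡n (toℕ≤pred[n] j)) (0ʲ1ˡ⊆⇒≤longest (toℕ j) (k ∸ toℕ j) w p))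

-- The automaton behind `C` and `E`, run on a single word; the clauses match, so that sums over
-- words unfold to those recursions.
accepted : ∀ {n} → Word n → ℕ → ℕ → Bool
accepted Vec.[]       d       r = 0 ℕ.<ᵇ r
accepted (0F Vec.∷ w) zero    r = accepted w 0 (pred r)
accepted (0F Vec.∷ w) (suc d) r = accepted w d r
accepted (1F Vec.∷ w) d       r = accepted w (suc d) (pred r)

-- If u is the prefix already read, a subsequence of the whole word switches from 0 to 1 in u or in
-- `w`. Its maximal length is therefore the maximum of L(u) + `ones w` and #zeros(u) + `longest w`,
-- where L(u) = k - r and #zeros(u) = k - r - d.
accepted⇒< : ∀ {n} (w : Word n) d r → T (accepted w d r) → ones w < r × longest w < r ℕ.+ d
accepted⇒< Vec.[]       d       (suc r) _ = z<s , z<s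
accepted⇒< (0F Vec.∷ w) zero    zero    t = contradiction (proj₁ (accepted⇒< w 0 0 t)) ℕₚ.n≮0
accepted⇒< (0F Vec.∷ w) zero    (suc r) t with accepted⇒< w 0 r t
... | o< , L< = ℕₚ.m<n⇒m<1+n o< , s<s L<
accepted⇒< (0F Vec.∷ w) (suc d) r       t with accepted⇒< w d r t
... | o< , L< = o< , subst (suc (longest w) <_) (sym (ℕₚ.+-suc r d)) (s<s L<)
accepted⇒< (1F Vec.∷ w) d       zero    t = contradiction (proj₁ (accepted⇒< w (suc d) 0 t)) ℕₚ.n≮0
accepted⇒< (1F Vec.∷ w) d       (suc r) t with accepted⇒< w (suc d) r t
... | o< , L< = s<s o< ,
  ℕₚ.⊔-pres-<m (s<s (ℕₚ.m≤n⇒m≤n+o d o<)) (subst (longest w <_) (ℕₚ.+-suc r d) L<)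

<⇒accepted : ∀ {n} (w : Word n) d r → ones w < r → longest w < r ℕ.+ d → T (accepted w d r)
<⇒accepted Vec.[]       d       (suc r) _  _  = _
<⇒accepted (0F Vec.∷ w) zero    (suc r) o< (s≤s L<) =
  -- The letter 0 lowers `r` here, so a sharper bound on `ones w` is required; at `d = 0` it follows
  -- from the bound on `longest w`.
  <⇒accepted w 0 r (ℕₚ.≤-<-trans (ones≤longest w) (subst (longest w <_) (ℕₚ.+-identityʳ r) L<)) L<
<⇒accepted (0F Vec.∷ w) (suc d) r       o< L< =
  <⇒accepted w d r o< (ℕₚ.≤-pred (subst (suc (longest w) <_) (ℕₚ.+-suc r d) L<))
<⇒accepted (1F Vec.∷ w) d       (suc r) (s≤s o<) L< =
  <⇒accepted w (suc d) r o<
    (subst (longest w <_) (sym (ℕₚ.+-suc r d)) (ℕₚ.m⊔n<o⇒n<o (suc (ones w)) (longest w) L<))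

T⇔⇒does≡ : ∀ {A : Set} b (a? : Dec A) → (A → T b) → (T b → A) → does a? ≡ b
T⇔⇒does≡ true  (yes a) f g = refl
T⇔⇒does≡ true  (no ¬a) f g = contradiction (g _) ¬a
T⇔⇒does≡ false (yes a) f g = ⊥-elim (f a)
T⇔⇒does≡ false (no ¬a) f g = refl

avoids≡accepted : ∀ k {n} (w : Word n) → does (avoids? k w) ≡ accepted w 0 k
avoids≡accepted k w = T⇔⇒does≡ (accepted w 0 k) (avoids? k w)
  (λ av → let L<k = avoids⇒longest< k w av in
    <⇒accepted w 0 k (ℕₚ.≤-<-trans (ones≤longest w) L<k) (subst (longest w <_) (sym (ℕₚ.+-identityʳ k)) L<k))
  (λ t → longest<⇒avoids k w (subst (longest w <_) (ℕₚ.+-identityʳ k) (proj₂ (accepted⇒< w 0 k t))))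

-- Parity of G w

filter-map : ∀ {A B : Set} {P : B → Set} (P? : Decidable P) (f : A → B) xs →
  filter P? (map f xs) ≡ map f (filter (P? ∘ f) xs)
filter-map P? f []       = refl
filter-map P? f (x ∷ xs) with does (P? (f x))
... | true  = cong (f x ∷_) (filter-map P? f xs)
... | false = filter-map P? f xs

positions : ∀ {n} → Fin 2 → Word n → List (Fin n)
positions {n} c w = filter (λ i → lookup w i ≟ᶠ c) (allFin n)

positions-tail : ∀ {n} c x (w : Word n) →
  filter (λ i → lookup (x Vec.∷ w) i ≟ᶠ c) (tabulate suc) ≡ map suc (positions c w)
positions-tail c x w =
  trans (cong (filter (λ i → lookup (x Vec.∷ w) i ≟ᶠ c)) (sym (map-tabulate id suc)))
        (filter-map (λ i → lookup (x Vec.∷ w) i ≟ᶠ c) suc (allFin _))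

zeros : ∀ {n} → Word n → ℕ
zeros Vec.[]       = 0
zeros (0F Vec.∷ w) = suc (zeros w)
zeros (1F Vec.∷ w) = zeros w

length-positions-0 : ∀ {n} (w : Word n) → length (positions 0F w) ≡ zeros w
length-positions-0 Vec.[] = refl
length-positions-0 (0F Vec.∷ w) = cong suc
  (trans (cong length (positions-tail 0F 0F w)) (trans (length-map suc (positions 0F w)) (length-positions-0 w)))
length-positions-0 (1F Vec.∷ w) =
  trans (cong length (positions-tail 0F 1F w)) (trans (length-map suc (positions 0F w)) (length-positions-0 w))

below-suc : ∀ {n} (x : Fin n) (ys : List (Fin n)) →
  length (filter (_<ᶠ? suc x) (map suc ys)) ≡ length (filter (_<ᶠ? x) ys)
below-suc x []       = refl
below-suc x (y ∷ ys) with does (y <ᶠ? x)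
... | true  = cong suc (below-suc x ys)
... | false = below-suc x ys

below-insert-zero : ∀ {n} (x : Fin n) (as bs : List (Fin n)) →
  length (filter (_<ᶠ? suc x) (map suc as ++ zero ∷ map suc bs)) ≡ suc (length (filter (_<ᶠ? x) (as ++ bs)))
below-insert-zero x []       bs = cong suc (below-suc x bs)
below-insert-zero x (a ∷ as) bs with does (a <ᶠ? x)
... | true  = cong suc (below-insert-zero x as bs)
... | false = below-insert-zero x as bs

below-zero : ∀ {n} (xs : List (Fin (suc n))) → length (filter (_<ᶠ? zero {n}) xs) ≡ 0
below-zero []       = refl
below-zero (x ∷ xs) = below-zero xs

inversions-suc : ∀ {n} (xs : List (Fin n)) → inversions (map suc xs) ≡ inversions xs
inversions-suc []       = refl
inversions-suc (x ∷ xs) = cong₂ ℕ._+_ (below-suc x xs) (inversions-suc xs)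

-- The least element is inverted with exactly the entries before it, and shifting the others by
-- `suc` keeps their order.
inversions-insert-zero : ∀ {n} (as bs : List (Fin n)) →
  inversions (map suc as ++ zero ∷ map suc bs) ≡ length as ℕ.+ inversions (as ++ bs)
inversions-insert-zero []       bs = cong₂ ℕ._+_ (below-zero (map suc bs)) (inversions-suc bs)
inversions-insert-zero (a ∷ as) bs = trans
  (cong₂ ℕ._+_ (below-insert-zero a as bs) (inversions-insert-zero as bs))
  (cong suc (x∙yz≈y∙xz (length (filter (_<ᶠ? a) (as ++ bs))) (length as) (inversions (as ++ bs))))

inversions-0∷ : ∀ {n} (w : Word n) → inversions (G (0F Vec.∷ w)) ≡ inversions (G w)
inversions-0∷ w = trans
  (cong inversions (cong₂ (λ as bs → zero ∷ as ++ bs) (positions-tail 0F 0F w) (positions-tail 1F 0F w)))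
  (trans (cong (inversions ∘ (zero ∷_)) (sym (map-++ suc (positions 0F w) (positions 1F w))))
         (inversions-insert-zero [] (G w)))

inversions-1∷ : ∀ {n} (w : Word n) → inversions (G (1F Vec.∷ w)) ≡ zeros w ℕ.+ inversions (G w)
inversions-1∷ w = trans
  (cong inversions (cong₂ (λ as bs → as ++ zero ∷ bs) (positions-tail 0F 1F w) (positions-tail 1F 1F w)))
  (trans (inversions-insert-zero (positions 0F w) (positions 1F w))
         (cong (ℕ._+ inversions (G w)) (length-positions-0 w)))

infixr 8 _^_

_^_ : Sign → ℕ → Sign
s ^ zero  = Sign.+
s ^ suc n = s Sign.* s ^ n

^-+ : ∀ s m n → s ^ (m ℕ.+ n) ≡ s ^ m Sign.* s ^ n
^-+ s zero    n = refl
^-+ s (suc m) n = trans (cong (s Sign.*_) (^-+ s m n)) (sym (Signₚ.*-assoc s (s ^ m) (s ^ n)))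

+^ : ∀ n → Sign.+ ^ n ≡ Sign.+
+^ zero    = refl
+^ (suc n) = +^ n

opposite-^ : ∀ s n → opposite s ^ n ≡ s ^ n Sign.* Sign.- ^ n
opposite-^ s zero = refl
opposite-^ Sign.+ (suc n) = sym (cong (Sign._* Sign.- ^ suc n) (+^ n))
opposite-^ Sign.- (suc n) = trans (+^ n) (sym (Signₚ.s*s≡+ (Sign.- ^ suc n)))

-- Inversions of `G w` correspond to a 1 standing before a 0. Each 0 thus contributes the parity of
-- the ones before it, and `s` records the parity of those read earlier.
sgn : ∀ {n} → Sign → Word n → Sign
sgn s Vec.[]       = Sign.+
sgn s (0F Vec.∷ w) = s Sign.* sgn s w
sgn s (1F Vec.∷ w) = sgn (opposite s) w

-- Ones read earlier are inverted with every 0 of `w`, whence the factor `s ^ zeros w`. A leading 1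
-- flips `s`, which multiplies that factor by the sign of its `zeros w` new inversions.
sgn-inversions : ∀ {n} s (w : Word n) → sgn s w ≡ s ^ zeros w Sign.* Sign.- ^ inversions (G w)
sgn-inversions s Vec.[] = refl
sgn-inversions s (0F Vec.∷ w)
  rewrite inversions-0∷ w | sgn-inversions s w
  = sym (Signₚ.*-assoc s (s ^ zeros w) _)
sgn-inversions s (1F Vec.∷ w)
  rewrite inversions-1∷ w | sgn-inversions (opposite s) w
        | opposite-^ s (zeros w) | ^-+ Sign.- (zeros w) (inversions (G w))
  = Signₚ.*-assoc (s ^ zeros w) _ _

even-or-odd : ∀ n → (∃ λ q → n ≡ q ℕ.* 2) ⊎ (∃ λ q → n ≡ suc (q ℕ.* 2))
even-or-odd zero = inj₁ (0 , refl)
even-or-odd (suc n) with even-or-odd n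
... | inj₁ (q , eq) = inj₂ (q , cong suc eq)
... | inj₂ (q , eq) = inj₁ (suc q , cong suc eq)

-^2q : ∀ q → Sign.- ^ (q ℕ.* 2) ≡ Sign.+
-^2q zero    = refl
-^2q (suc q) rewrite -^2q q = refl

-- Stated for an arbitrary decision, so that it applies to the one inside `oddWord?`.
-^-parity : ∀ n (2∣n? : Dec (2 ∣ n)) → Sign.- ^ n ≡ (if not (does 2∣n?) then Sign.- else Sign.+)
-^-parity n (yes (divides q refl)) = -^2q q
-^-parity n (no 2∤n) with even-or-odd n
... | inj₁ (q , eq)   = contradiction (divides q eq) 2∤n
... | inj₂ (q , refl) = cong opposite (-^2q q)

sgn-oddWord : ∀ {n} (w : Word n) → sgn Sign.+ w ≡ (if does (oddWord? w) then Sign.- else Sign.+)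
sgn-oddWord w = trans (sgn-inversions Sign.+ w)
  (trans (cong (Sign._* (Sign.- ^ inversions (G w))) (+^ (zeros w))) (-^-parity (inversions (G w)) (2 ∣? inversions (G w))))

-- Counts as sums over all words

sumOver : ∀ {A : Set} → (A → ℤ) → List A → ℤ
sumOver f []       = 0ℤ
sumOver f (x ∷ xs) = f x + sumOver f xs

sumOver-cong : ∀ {A : Set} {f g : A → ℤ} → (∀ x → f x ≡ g x) → ∀ xs → sumOver f xs ≡ sumOver g xs
sumOver-cong f≗g []       = refl
sumOver-cong f≗g (x ∷ xs) = cong₂ _+_ (f≗g x) (sumOver-cong f≗g xs)

sumOver-++ : ∀ {A : Set} (f : A → ℤ) xs ys → sumOver f (xs ++ ys) ≡ sumOver f xs + sumOver f ys
sumOver-++ f []       ys = sym (+-identityˡ _)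
sumOver-++ f (x ∷ xs) ys = trans (cong (λ t → f x + t) (sumOver-++ f xs ys)) (sym (+-assoc (f x) _ _))

sumOver-map : ∀ {A B : Set} (f : B → ℤ) (g : A → B) xs → sumOver f (map g xs) ≡ sumOver (f ∘ g) xs
sumOver-map f g []       = refl
sumOver-map f g (x ∷ xs) = cong (λ t → f (g x) + t) (sumOver-map f g xs)

sumOver-* : ∀ {A : Set} c (f : A → ℤ) xs → sumOver (λ x → c * f x) xs ≡ c * sumOver f xs
sumOver-* c f []       = sym (*-zeroʳ c)
sumOver-* c f (x ∷ xs) = trans (cong (λ t → c * f x + t) (sumOver-* c f xs)) (sym (*-distribˡ-+ c (f x) _))

sumOver-words : ∀ {n} (f : Word (suc n) → ℤ) →
  sumOver f (words (suc n)) ≡ sumOver (f ∘ (0F Vec.∷_)) (words n) + sumOver (f ∘ (1F Vec.∷_)) (words n)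
sumOver-words {n} f = trans (sumOver-++ f (map (0F Vec.∷_) (words n)) _)
  (cong₂ _+_ (sumOver-map f (0F Vec.∷_) (words n))
    -- The product with a two-letter list unfolds with a trailing empty list.
    (trans (sumOver-++ f (map (1F Vec.∷_) (words n)) [])
      (trans (+-identityʳ _) (sumOver-map f (1F Vec.∷_) (words n)))))

ι : Bool → ℤ
ι b = if b then 1ℤ else 0ℤ

length-filter : ∀ {A : Set} {P : A → Set} (P? : Decidable P) xs →
  + length (filter P? xs) ≡ sumOver (λ x → ι (does (P? x))) xs
length-filter P? []       = refl
length-filter P? (x ∷ xs) with does (P? x)
... | true  = cong (λ t → 1ℤ + t) (length-filter P? xs)
... | false = trans (length-filter P? xs) (sym (+-identityˡ _))

sumOver-accepted : ∀ n d r → sumOver (λ w → ι (accepted w d r)) (words n) ≡ C n d r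
sumOver-accepted zero    d       zero    = refl
sumOver-accepted zero    d       (suc r) = refl
sumOver-accepted (suc n) zero    r       = trans (sumOver-words {n} _)
  (cong₂ _+_ (sumOver-accepted n 0 (pred r)) (sumOver-accepted n 1 (pred r)))
sumOver-accepted (suc n) (suc d) r       = trans (sumOver-words {n} _)
  (cong₂ _+_ (sumOver-accepted n d r) (sumOver-accepted n (suc (suc d)) (pred r)))

weight : ∀ {n} → Sign → ℕ → ℕ → Word n → ℤ
weight s d r w = if accepted w d r then σ (sgn s w) else 0ℤ

σ-* : ∀ s t → σ (s Sign.* t) ≡ σ s * σ t
σ-* Sign.+ Sign.+ = refl
σ-* Sign.+ Sign.- = refl
σ-* Sign.- Sign.+ = refl
σ-* Sign.- Sign.- = refl

if-σ-* : ∀ b s t → (if b then σ (s Sign.* t) else 0ℤ) ≡ σ s * (if b then σ t else 0ℤ)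
if-σ-* true  s t = σ-* s t
if-σ-* false s t = sym (*-zeroʳ (σ s))

-- A leading 0 multiplies every sign by `s`, a factor that leaves the sum; a leading 1 only changes
-- the state.
sumOver-weight : ∀ n s d r → sumOver (weight s d r) (words n) ≡ E n s d r
sumOver-weight zero    s d       zero    = refl
sumOver-weight zero    s d       (suc r) = refl
sumOver-weight (suc n) s zero    r       = trans (sumOver-words {n} _)
  (cong₂ _+_
    (trans (sumOver-cong (λ w → if-σ-* (accepted w 0 (pred r)) s (sgn s w)) (words n))
      (trans (sumOver-* (σ s) (weight s 0 (pred r)) (words n)) (cong (σ s *_) (sumOver-weight n s 0 (pred r)))))
    (sumOver-weight n (opposite s) 1 (pred r)))
sumOver-weight (suc n) s (suc d) r       = trans (sumOver-words {n} _)
  (cong₂ _+_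
    (trans (sumOver-cong (λ w → if-σ-* (accepted w d r) s (sgn s w)) (words n))
      (trans (sumOver-* (σ s) (weight s d r) (words n)) (cong (σ s *_) (sumOver-weight n s d r))))
    (sumOver-weight n (opposite s) (suc (suc d)) (pred r)))

length-avoids : ∀ k m → + length (filter (avoids? k) (words m)) ≡ C m 0 k
length-avoids k m = trans (length-filter (avoids? k) (words m))
  (trans (sumOver-cong (λ w → cong ι (avoids≡accepted k w)) (words m)) (sumOver-accepted m 0 k))

-- The convention for `B 0 m` agrees with the rejecting sink `r = 0`.
B≡C : ∀ k m → + B k m ≡ C m 0 k
B≡C zero    m = sym (C-zero m 0)
B≡C (suc k) m = length-avoids (suc k) m

-- The sign of a word is 1 minus twice the indicator of oddness.
indicator-split : ∀ b o → ι b ≡ + 2 * ι (b ∧ o) + (if b then σ (if o then Sign.- else Sign.+) else 0ℤ)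
indicator-split true  true  = refl
indicator-split true  false = refl
indicator-split false o     = refl

sumOver-split : ∀ {A : Set} (f g h : A → ℤ) → (∀ x → f x ≡ + 2 * g x + h x) →
  ∀ xs → sumOver f xs ≡ + 2 * sumOver g xs + sumOver h xs
sumOver-split f g h eq []       = refl
sumOver-split f g h eq (x ∷ xs) = trans (cong₂ _+_ (eq x) (sumOver-split f g h eq xs))
  (identity (g x) (h x) (sumOver g xs) (sumOver h xs))
  where
  identity : ∀ a b c d → + 2 * a + b + (+ 2 * c + d) ≡ + 2 * (a + c) + (b + d)
  identity = solve-∀

B≡2O+E : ∀ k m → + B k m ≡ + 2 * + O k m + E m Sign.+ 0 k
B≡2O+E k m = begin
  + B k m
    ≡⟨ B≡C k m ⟩
  C m 0 k
    ≡⟨ sumOver-accepted m 0 k ⟨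
  sumOver (λ w → ι (accepted w 0 k)) (words m)
    ≡⟨ sumOver-split _ (λ w → ι (does (avoids? k w ×-dec oddWord? w))) (weight Sign.+ 0 k) split (words m) ⟩
  + 2 * sumOver (λ w → ι (does (avoids? k w ×-dec oddWord? w))) (words m) + sumOver (weight Sign.+ 0 k) (words m)
    ≡⟨ cong₂ (λ a b → + 2 * a + b) (sym (length-filter (λ w → avoids? k w ×-dec oddWord? w) (words m))) (sumOver-weight m Sign.+ 0 k) ⟩
  + 2 * + O k m + E m Sign.+ 0 k
    ∎
  where
  open ≡-Reasoning
  split : ∀ w → ι (accepted w 0 k) ≡
    + 2 * ι (does (avoids? k w ×-dec oddWord? w)) + weight Sign.+ 0 k w
  split w rewrite sgn-oddWord w | sym (avoids≡accepted k w) = indicator-split (does (avoids? k w)) (does (oddWord? w))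

2O≡B-E : ∀ k m {e} → E m Sign.+ 0 k ≡ e → + 2 * + O k m ≡ + B k m - e
2O≡B-E k m refl = trans (identity _ (E m Sign.+ 0 k)) (cong (_- E m Sign.+ 0 k) (sym (B≡2O+E k m)))
  where
  identity : ∀ a b → a ≡ a + b - b
  identity = solve-∀

-- Halved arguments and the four parity cases

2q/2≡q : ∀ q → q ℕ.* 2 / 2 ≡ q
2q/2≡q q = m*n/n≡m q 2

[1+2q]/2≡q : ∀ q → suc (q ℕ.* 2) / 2 ≡ q
[1+2q]/2≡q q = trans (+-distrib-/-∣ʳ 1 {q ℕ.* 2} {2} (divides q refl)) (2q/2≡q q)

[2q∸2]/2≡pred : ∀ q → (q ℕ.* 2 ∸ 2) / 2 ≡ pred q
[2q∸2]/2≡pred zero    = refl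
[2q∸2]/2≡pred (suc q) = 2q/2≡q q

theorem4p4 : (k m : ℕ) → 1 ≤ k → 1 ≤ m →
    (2 ∣ k × 2 ∣ m →
    + 2 * + O k m ≡ + B k m + + B (k / 2) ((m ∸ 2) / 2) - + B (k / 2) (m / 2) - + B ((k ∸ 2) / 2) ((m ∸ 2) / 2))
    × (¬ (2 ∣ k × 2 ∣ m) →
    + 2 * + O k m ≡ + B k m - + 2 * + B (k / 2) ((m ∸ 1) / 2))
theorem4p4 k m _ 1≤m = both-even 1≤m , otherwise 1≤m
  where
  conclude-even : ∀ {j j′ n n′} → k / 2 ≡ j → (k ∸ 2) / 2 ≡ j′ → m / 2 ≡ n → (m ∸ 2) / 2 ≡ n′ →
    E m Sign.+ 0 k ≡ C n 0 j + C n′ 0 j′ - C n′ 0 j →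
    + 2 * + O k m ≡ + B k m + + B (k / 2) ((m ∸ 2) / 2) - + B (k / 2) (m / 2) - + B ((k ∸ 2) / 2) ((m ∸ 2) / 2)
  conclude-even {j} {j′} {n} {n′} refl refl refl refl eq = trans
    (2O≡B-E k m (trans eq (sym (cong₂ _-_ (cong₂ _+_ (B≡C j n) (B≡C j′ n′)) (B≡C j n′)))))
    (identity (+ B k m) (+ B j n) (+ B j′ n′) (+ B j n′))
    where
    identity : ∀ b c a d → b - (c + a - d) ≡ b + d - c - a
    identity = solve-∀

  both-even : 1 ≤ m → 2 ∣ k × 2 ∣ m →
    + 2 * + O k m ≡ + B k m + + B (k / 2) ((m ∸ 2) / 2) - + B (k / 2) (m / 2) - + B ((k ∸ 2) / 2) ((m ∸ 2) / 2)
  -- Since `m` is positive, its half is a successor, as the closed form for even length requires.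
  both-even _ (divides j refl , divides (suc n) refl) =
    conclude-even (2q/2≡q j) ([2q∸2]/2≡pred j) (2q/2≡q (suc n)) (2q/2≡q n) (E-even-length-even n j)

  conclude : ∀ {j n} → k / 2 ≡ j → (m ∸ 1) / 2 ≡ n → E m Sign.+ 0 k ≡ + 2 * C n 0 j →
    + 2 * + O k m ≡ + B k m - + 2 * + B (k / 2) ((m ∸ 1) / 2)
  conclude {j} {n} refl refl eq = 2O≡B-E k m (trans eq (cong (+ 2 *_) (sym (B≡C j n))))

  otherwise : 1 ≤ m → ¬ (2 ∣ k × 2 ∣ m) → + 2 * + O k m ≡ + B k m - + 2 * + B (k / 2) ((m ∸ 1) / 2)
  otherwise _ ¬even with even-or-odd k | even-or-odd m
  ... | inj₁ (j , refl) | inj₁ (n , refl)     = contradiction (divides j refl , divides n refl) ¬even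
  ... | inj₁ (j , refl) | inj₂ (n , refl)     = conclude (2q/2≡q j) (2q/2≡q n) (E-odd-length-even n j)
  -- Here `m ∸ 1` is `suc (n * 2)`, whose half rounds down to `n`.
  ... | inj₂ (j , refl) | inj₁ (suc n , refl) = conclude ([1+2q]/2≡q j) ([1+2q]/2≡q n) (E-even-length-odd n j)
  ... | inj₂ (j , refl) | inj₂ (n , refl)     = conclude ([1+2q]/2≡q j) (2q/2≡q n) (E-odd-length-odd n j)
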